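{- There is no minion homomorphism $\mathcal V_2\text{ - }\mathbb Z_2\to\mathcal Z_8$.
   Context: A minion $\mathcal R$ is a functor from finite sets to sets: it assigns a set $\mathcal R^{(D)}$ to each finite set $D$ and a map $\mathcal R^{(\alpha)}:\mathcal R^{(D)}\to\mathcal R^{(E)}$ to each function $\alpha:D\to E$ between finite sets, preserving identities and composition. A minion homomorphism $\xi:\mathcal R\to\mathcal S$ is a natural transformation: a family of functions $\xi^{(D)}:\mathcal R^{(D)}\to\mathcal S^{(D)}$ with $\xi^{(E)}\circ\mathcal R^{(\alpha)}=\mathcal S^{(\alpha)}\circ\xi^{(D)}$ for every $\alpha:D\to E$. For $m\in\mathbb N$, the minion $\mathcal Z_m$ is given by $\mathcal Z_m^{(D)}=\{f:D\to\mathbb Z_m\mid\sum_{a\in D}f(a)=1\}$ (where $\mathbb Z_m$ is the ring of integers modulo $m$), and for $\alpha:D\to E$, $\mathcal Z_m^{(\alpha)}(f)(b)=\sum_{a\in\alpha^{ -1}(b)}f(a)$. For a prime $p$, the minion $\mathcal V_2\text{ - }\mathbb Z_p$ is defined as follows; all computations are in the field $\mathbb Z_p$. For vectors in $\mathbb Z_p^N$ let $\mathfrak w(v_1,\dots,v_N)=v_1+\cdots+v_N$ and let $\odot$ denote the componentwise product. For a finite set $D$, $(\mathcal V_2\text{ - }\mathbb Z_p)^{(D)}$ is the set of triples $(V,\mathbf i,\mathbf v)$ where $V$ is a linear subspace of $\mathbb Z_p^N$ for some $N\in\mathbb N$, $\mathbf i\in V$, and $\mathbf v:D\to V$, such that: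 (i) $\mathbf i=(1,1,\dots,1)$ and $\mathfrak w(\mathbf i)=1$; (s) $\sum_{a\in D}\mathbf v(a)=\mathbf i$; (o) $\mathfrak w(\mathbf v(a)\odot\mathbf v(b))=0$ for all $a\ne b$ in $D$; (p) $\mathfrak w(\mathbf v(a)\odot\mathbf v(a))=\mathfrak w(\mathbf v(a))$ for all $a\in D$. For $\alpha:D\to E$, $(\mathcal V_2\text{ - }\mathbb Z_p)^{(\alpha)}(V,\mathbf i,\mathbf v)=(V,\mathbf i,\mathbf v')$ with $\mathbf v'(b)=\sum_{a\in\alpha^{ -1}(b)}\mathbf v(a)$. The claim concerns $p=2$. -}

module Defs where

open import Algebra.Bundles using (CommutativeMonoid; CommutativeRing)
import Algebra.Construct.Pointwise as Pointwise
import Algebra.Properties.CommutativeMonoid.Sum as CMSum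
open import Data.Bool.Base using (if_then_else_)
open import Data.Empty using (⊥-elim)
open import Data.Fin.Base using (Fin; zero; suc; punchIn)
import Data.Fin.Properties as Fin
open import Data.Integer.Base as ℤ using (ℤ; +_)
open import Data.Integer.Divisibility.Signed
  using (_∣_; divides; ∣m∣n⇒∣m+n; ∣m⇒∣-m; ∣m⇒∣m*n; ∣n⇒∣m*n)
import Data.Integer.Properties as ℤ
open import Data.Integer.Tactic.RingSolver using (solve-∀)
open import Data.Nat.Base using (ℕ)
open import Data.Nat.Primality using (Prime)
open import Data.Product.Base using (_,_; Σ)
open import Function.Base using (_∘_; id)
open import Function.Bundles using (_↔_; Func; _⟨$⟩_; Inverse)
open import Function.Properties.Inverse using (↔⇒↣)
open import Level using (Level; 0ℓ; _⊔_) renaming (suc to lsuc)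
open import Relation.Binary.Bundles using (Setoid)
open import Relation.Binary.Definitions using (DecidableEquality)
open import Relation.Binary.PropositionalEquality
  using (_≡_; _≢_; _≗_; refl; sym; trans; cong; subst)
import Relation.Binary.Reasoning.Setoid as SetoidReasoning
open import Relation.Nullary using (Dec; yes; no; does)
open import Relation.Unary using (Pred; _≐_)

private
  variable
    c c′ ℓ ℓ′ : Level

------------------------------------------------------------------------
-- Finite sets

-- A finite set comes with an enumeration, used to define sums over it and
-- decidable equality on it.

record FinSet : Set₁ where
  field
    Carrier     : Set
    size        : ℕ
    enumeration : Carrier ↔ Fin size

  open Inverse enumeration public using (to; from; strictlyInverseˡ; strictlyInverseʳ)

  infix 4 _≟_
  _≟_ : DecidableEquality Carrier
  _≟_ = Fin.inj⇒≟ (↔⇒↣ enumeration)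

∣_∣ : FinSet → Set
∣_∣ = FinSet.Carrier

------------------------------------------------------------------------
-- Minions and their homomorphisms

-- Sets are setoids, and functions between finite sets are compared
-- pointwise; `map-resp` says that `map` respects the latter equality.

record Minion (c ℓ : Level) : Set (lsuc (lsuc 0ℓ ⊔ c ⊔ ℓ)) where
  field
    obj : FinSet → Setoid c ℓ
    map : ∀ {D E} → (∣ D ∣ → ∣ E ∣) → Func (obj D) (obj E)

  module Obj (D : FinSet) = Setoid (obj D)

  field
    map-resp : ∀ {D E} {α β : ∣ D ∣ → ∣ E ∣} → α ≗ β →
               ∀ x → Obj._≈_ E (map {D} {E} α ⟨$⟩ x) (map {D} {E} β ⟨$⟩ x)
    map-id   : ∀ {D} x → Obj._≈_ D (map {D} {D} id ⟨$⟩ x) x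
    map-∘    : ∀ {D E F} (β : ∣ E ∣ → ∣ F ∣) (α : ∣ D ∣ → ∣ E ∣) x →
               Obj._≈_ F (map {D} {F} (β ∘ α) ⟨$⟩ x)
                         (map {E} {F} β ⟨$⟩ (map {D} {E} α ⟨$⟩ x))

record MinionHom (R : Minion c ℓ) (S : Minion c′ ℓ′) :
                 Set (lsuc 0ℓ ⊔ c ⊔ ℓ ⊔ c′ ⊔ ℓ′) where
  private
    module R = Minion R
    module S = Minion S
  field
    ξ       : ∀ D → Func (R.obj D) (S.obj D)
    natural : ∀ {D E} (α : ∣ D ∣ → ∣ E ∣) x →
              S.Obj._≈_ E (ξ E ⟨$⟩ (R.map {D} {E} α ⟨$⟩ x))
                          (S.map {D} {E} α ⟨$⟩ (ξ D ⟨$⟩ x))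

------------------------------------------------------------------------
-- Sums over finite sets

module FinSum (M : CommutativeMonoid c ℓ) where
  open CommutativeMonoid M
    renaming (Carrier to A; _∙_ to _+_; ε to 0#; refl to ≈-refl; sym to ≈-sym;
              trans to ≈-trans; reflexive to ≈-reflexive)
  open CMSum M
  open SetoidReasoning setoid

  ∑ : (D : FinSet) → (∣ D ∣ → A) → A
  ∑ D f = sum (f ∘ FinSet.from D)

  when : ∀ {P : Set} → Dec P → A → A
  when d x = if does d then x else 0#

  -- push D E α f b is the sum of f a over a ∈ α⁻¹(b).
  push : (D E : FinSet) → (∣ D ∣ → ∣ E ∣) → (∣ D ∣ → A) → (∣ E ∣ → A)
  push D E α f b = ∑ D (λ a → when (α a ≟ b) (f a))
    where open FinSet E using (_≟_)

  ∑-cong : ∀ D (f g : ∣ D ∣ → A) → (∀ a → f a ≈ g a) → ∑ D f ≈ ∑ D g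
  ∑-cong D f g f≈g = sum-cong-≋ (f≈g ∘ FinSet.from D)

  ∑-swap : ∀ D E (f : ∣ D ∣ → ∣ E ∣ → A) →
           ∑ D (λ a → ∑ E (f a)) ≈ ∑ E (λ b → ∑ D (λ a → f a b))
  ∑-swap D E f = ∑-comm (λ i j → f (FinSet.from D i) (FinSet.from E j))

  sum-zero : ∀ {n} (f : Fin n → A) → (∀ i → f i ≈ 0#) → sum f ≈ 0#
  sum-zero {n} f f≈0 = ≈-trans (sum-cong-≋ f≈0) (sum-replicate-zero n)

  ∑-zero : ∀ D {f : ∣ D ∣ → A} → (∀ a → f a ≈ 0#) → ∑ D f ≈ 0#
  ∑-zero D f≈0 = sum-zero _ (f≈0 ∘ FinSet.from D)

  sum-single : ∀ {n} (f : Fin n → A) i → (∀ j → j ≢ i → f j ≈ 0#) → sum f ≈ f i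
  sum-single {ℕ.suc n} f i z = begin
    sum f                              ≈⟨ sum-remove {i = i} f ⟩
    f i + sum (f ∘ punchIn i)          ≈⟨ ∙-congˡ (sum-zero _ (λ j → z _ (Fin.punchInᵢ≢i i j))) ⟩
    f i + 0#                           ≈⟨ identityʳ _ ⟩
    f i                                ∎

  ∑-single : ∀ D (f : ∣ D ∣ → A) b → (∀ a → a ≢ b → f a ≈ 0#) → ∑ D f ≈ f b
  ∑-single D f b z = ≈-trans
    (sum-single (f ∘ from) (to b)
      (λ j j≢ → z _ (λ e → j≢ (trans (sym (strictlyInverseˡ j)) (cong to e)))))
    (≈-reflexive (cong f (strictlyInverseʳ b)))
    where open FinSet D

  when-cong : ∀ {P : Set} (d : Dec P) {x y} → (P → x ≈ y) → when d x ≈ when d y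
  when-cong (yes p) x≈y = x≈y p
  when-cong (no _)  _   = ≈-refl

  when-yes : ∀ {P : Set} (d : Dec P) {x} → P → when d x ≈ x
  when-yes (yes _) _ = ≈-refl
  when-yes (no ¬p) p = ⊥-elim (¬p p)

  when-no : ∀ {P : Set} (d : Dec P) {x} → (P → x ≈ 0#) → when d x ≈ 0#
  when-no (yes p) x≈0 = x≈0 p
  when-no (no _)  _   = ≈-refl

  when-∑ : ∀ {P : Set} (d : Dec P) D (f : ∣ D ∣ → A) →
           when d (∑ D f) ≈ ∑ D (λ a → when d (f a))
  when-∑ (yes _) D f = ≈-refl
  when-∑ (no _)  D f = ≈-sym (∑-zero D (λ _ → ≈-refl))

  push-cong : ∀ D E α {f g : ∣ D ∣ → A} → (∀ a → f a ≈ g a) →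
              ∀ b → push D E α f b ≈ push D E α g b
  push-cong D E α {f} {g} f≈g b =
    ∑-cong D (λ a → when (α a ≟ b) (f a)) (λ a → when (α a ≟ b) (g a))
      (λ a → when-cong (α a ≟ b) (λ _ → f≈g a))
    where open FinSet E using (_≟_)

  push-resp : ∀ D E {α β : ∣ D ∣ → ∣ E ∣} → α ≗ β → ∀ f b →
              push D E α f b ≈ push D E β f b
  push-resp D E {α} {β} α≗β f b =
    ∑-cong D (λ a → when (α a ≟ b) (f a)) (λ a → when (β a ≟ b) (f a))
      (λ a → ≈-reflexive (cong (λ e → when (e ≟ b) (f a)) (α≗β a)))
    where open FinSet E using (_≟_)

  push-id : ∀ D f b → push D D id f b ≈ f b
  push-id D f b = ≈-trans
    (∑-single D _ b (λ a a≢b → when-no (a ≟ b) (λ e → ⊥-elim (a≢b e))))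
    (when-yes (b ≟ b) refl)
    where open FinSet D

  push-∘ : ∀ D E F (β : ∣ E ∣ → ∣ F ∣) (α : ∣ D ∣ → ∣ E ∣) f z →
           push D F (β ∘ α) f z ≈ push E F β (push D E α f) z
  push-∘ D E F β α f z = ≈-sym (begin
    ∑ E (λ b → when (β b F.≟ z) (∑ D (g b)))
      ≈⟨ ∑-cong E (λ b → when (β b F.≟ z) (∑ D (g b))) (λ b → ∑ D (h b))
           (λ b → when-∑ (β b F.≟ z) D (g b)) ⟩
    ∑ E (λ b → ∑ D (h b))
      ≈⟨ ∑-swap E D h ⟩
    ∑ D (λ a → ∑ E (λ b → h b a))
      ≈⟨ ∑-cong D (λ a → ∑ E (λ b → h b a)) (λ a → when (β (α a) F.≟ z) (f a)) fibre ⟩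
    ∑ D (λ a → when (β (α a) F.≟ z) (f a)) ∎)
    where
    module E = FinSet E
    module F = FinSet F
    g h : ∣ E ∣ → ∣ D ∣ → A
    g b a = when (α a E.≟ b) (f a)
    h b a = when (β b F.≟ z) (g b a)
    fibre : ∀ a → ∑ E (λ b → h b a) ≈ when (β (α a) F.≟ z) (f a)
    fibre a = ≈-trans
      (∑-single E (λ b → h b a) (α a) (λ b b≢ →
        when-no (β b F.≟ z) (λ _ → when-no (α a E.≟ b) (λ e → ⊥-elim (b≢ (sym e))))))
      (when-cong (β (α a) F.≟ z) (λ _ → when-yes (α a E.≟ α a) refl))

  ∑-push : ∀ D E (α : ∣ D ∣ → ∣ E ∣) f → ∑ E (push D E α f) ≈ ∑ D f
  ∑-push D E α f = begin
    ∑ E (λ b → ∑ D (g b))          ≈⟨ ∑-swap E D g ⟩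
    ∑ D (λ a → ∑ E (λ b → g b a))  ≈⟨ ∑-cong D (λ a → ∑ E (λ b → g b a)) f fibre ⟩
    ∑ D f                          ∎
    where
    open FinSet E using (_≟_)
    g : ∣ E ∣ → ∣ D ∣ → A
    g b a = when (α a ≟ b) (f a)
    fibre : ∀ a → ∑ E (λ b → g b a) ≈ f a
    fibre a = ≈-trans
      (∑-single E (λ b → g b a) (α a) (λ b b≢ → when-no (α a ≟ b) (λ e → ⊥-elim (b≢ (sym e)))))
      (when-yes (α a ≟ α a) refl)

module PushHom
  (M : CommutativeMonoid c ℓ) (N : CommutativeMonoid c′ ℓ′)
  (h : CommutativeMonoid.Carrier M → CommutativeMonoid.Carrier N)
  (h-0 : CommutativeMonoid._≈_ N (h (CommutativeMonoid.ε M)) (CommutativeMonoid.ε N))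
  (h-+ : ∀ x y → CommutativeMonoid._≈_ N (h (CommutativeMonoid._∙_ M x y))
                                         (CommutativeMonoid._∙_ N (h x) (h y))) where

  private
    module M = CommutativeMonoid M
    module N = CommutativeMonoid N
    module FM = FinSum M
    module FN = FinSum N

  h-sum : ∀ {n} (f : Fin n → M.Carrier) → h (CMSum.sum M f) N.≈ CMSum.sum N (h ∘ f)
  h-sum {ℕ.zero}  f = h-0
  h-sum {ℕ.suc n} f = N.trans (h-+ _ _) (N.∙-congˡ (h-sum (f ∘ suc)))

  h-when : ∀ {P : Set} (d : Dec P) x → h (FM.when d x) N.≈ FN.when d (h x)
  h-when (yes _) x = N.refl
  h-when (no _)  x = h-0

  h-push : ∀ D E α f b → h (FM.push D E α f b) N.≈ FN.push D E α (h ∘ f) b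
  h-push D E α f b =
    N.trans (h-sum (λ i → FM.when (α (FinSet.from D i) ≟ b) (f (FinSet.from D i))))
      (FN.∑-cong D (λ a → h (FM.when (α a ≟ b) (f a))) (λ a → FN.when (α a ≟ b) (h (f a)))
        (λ a → h-when (α a ≟ b) (f a)))
    where open FinSet E using (_≟_)

------------------------------------------------------------------------
-- The ring ℤ/mℤ, as the setoid of integers up to congruence modulo m

infix 4 _≡_[mod_]

record _≡_[mod_] (x y : ℤ) (m : ℕ) : Set where
  constructor congruent
  field
    m∣x-y : + m ∣ x ℤ.- y

ℤ/_ : ℕ → CommutativeRing 0ℓ 0ℓ
ℤ/ m = record
  { Carrier = ℤ
  ; _≈_     = λ x y → x ≡ y [mod m ]
  ; _+_     = ℤ._+_
  ; _*_     = ℤ._*_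
  ; -_      = ℤ.-_
  ; 0#      = ℤ.0ℤ
  ; 1#      = ℤ.1ℤ
  ; isCommutativeRing = record
    { isRing = record
      { +-isAbelianGroup = record
        { isGroup = record
          { isMonoid = record
            { isSemigroup = record
              { isMagma = record
                { isEquivalence = record { refl = of refl ; sym = ≈-sym ; trans = ≈-trans }
                ; ∙-cong = +-cong
                }
              ; assoc = λ x y z → of (ℤ.+-assoc x y z)
              }
            ; identity = (λ x → of (ℤ.+-identityˡ x)) , (λ x → of (ℤ.+-identityʳ x))
            }
          ; inverse = (λ x → of (ℤ.+-inverseˡ x)) , (λ x → of (ℤ.+-inverseʳ x))
          ; ⁻¹-cong = neg-cong
          }
        ; comm = λ x y → of (ℤ.+-comm x y)
        }
      ; *-cong = *-cong
      ; *-assoc = λ x y z → of (ℤ.*-assoc x y z)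
      ; *-identity = (λ x → of (ℤ.*-identityˡ x)) , (λ x → of (ℤ.*-identityʳ x))
      ; distrib = (λ x y z → of (ℤ.*-distribˡ-+ x y z)) , (λ x y z → of (ℤ.*-distribʳ-+ x y z))
      }
    ; *-comm = λ x y → of (ℤ.*-comm x y)
    }
  }
  where
  of : ∀ {x y} → x ≡ y → x ≡ y [mod m ]
  of {x} refl = congruent (divides ℤ.0ℤ (ℤ.+-inverseʳ x))

  ≈-sym : ∀ {x y} → x ≡ y [mod m ] → y ≡ x [mod m ]
  ≈-sym {x} {y} (congruent d) = congruent (subst (+ m ∣_) (lem x y) (∣m⇒∣-m d))
    where
    lem : ∀ x y → ℤ.- (x ℤ.- y) ≡ y ℤ.- x
    lem = solve-∀

  ≈-trans : ∀ {x y z} → x ≡ y [mod m ] → y ≡ z [mod m ] → x ≡ z [mod m ]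
  ≈-trans {x} {y} {z} (congruent d) (congruent e) =
    congruent (subst (+ m ∣_) (lem x y z) (∣m∣n⇒∣m+n d e))
    where
    lem : ∀ x y z → (x ℤ.- y) ℤ.+ (y ℤ.- z) ≡ x ℤ.- z
    lem = solve-∀

  +-cong : ∀ {x y u v} → x ≡ y [mod m ] → u ≡ v [mod m ] → x ℤ.+ u ≡ y ℤ.+ v [mod m ]
  +-cong {x} {y} {u} {v} (congruent d) (congruent e) =
    congruent (subst (+ m ∣_) (lem x y u v) (∣m∣n⇒∣m+n d e))
    where
    lem : ∀ x y u v → (x ℤ.- y) ℤ.+ (u ℤ.- v) ≡ (x ℤ.+ u) ℤ.- (y ℤ.+ v)
    lem = solve-∀

  neg-cong : ∀ {x y} → x ≡ y [mod m ] → ℤ.- x ≡ ℤ.- y [mod m ]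
  neg-cong {x} {y} (congruent d) = congruent (subst (+ m ∣_) (lem x y) (∣m⇒∣-m d))
    where
    lem : ∀ x y → ℤ.- (x ℤ.- y) ≡ (ℤ.- x) ℤ.- (ℤ.- y)
    lem = solve-∀

  *-cong : ∀ {x y u v} → x ≡ y [mod m ] → u ≡ v [mod m ] → x ℤ.* u ≡ y ℤ.* v [mod m ]
  *-cong {x} {y} {u} {v} (congruent d) (congruent e) =
    congruent (subst (+ m ∣_) (lem x y u v) (∣m∣n⇒∣m+n (∣m⇒∣m*n u d) (∣n⇒∣m*n y e)))
    where
    lem : ∀ x y u v → (x ℤ.- y) ℤ.* u ℤ.+ y ℤ.* (u ℤ.- v) ≡ x ℤ.* u ℤ.- y ℤ.* v
    lem = solve-∀

------------------------------------------------------------------------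
-- The minion 𝒵ₘ

module _ (m : ℕ) where
  open CommutativeRing (ℤ/ m) using (_≈_; 1#; +-commutativeMonoid)
    renaming (refl to ≈-refl; sym to ≈-sym; trans to ≈-trans; Carrier to ℤₘ)
  open FinSum +-commutativeMonoid

  record 𝒵-Elem (D : FinSet) : Set where
    constructor _,_
    field
      f     : ∣ D ∣ → ℤₘ
      sum-1 : ∑ D f ≈ 1#

  open 𝒵-Elem

  𝒵 : Minion 0ℓ 0ℓ
  𝒵 = record
    { obj = λ D → record
      { Carrier = 𝒵-Elem D
      ; _≈_ = λ x y → ∀ a → f x a ≈ f y a
      ; isEquivalence = record
        { refl  = λ _ → ≈-refl
        ; sym   = λ e a → ≈-sym (e a)
        ; trans = λ e e′ a → ≈-trans (e a) (e′ a)
        }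
      }
    ; map = λ {D} {E} α → record
      { to   = λ x → push D E α (f x) , ≈-trans (∑-push D E α (f x)) (sum-1 x)
      ; cong = push-cong D E α
      }
    ; map-resp = λ {D} {E} α≗β x → push-resp D E α≗β (f x)
    ; map-id   = λ {D} x → push-id D (f x)
    ; map-∘    = λ {D} {E} {F} β α x → push-∘ D E F β α (f x)
    }

------------------------------------------------------------------------
-- The minion 𝒱₂-ℤₚ

-- The construction uses only the ring operations of ℤₚ, so it is carried out
-- over a commutative ring K; a Subspace is then a submodule of Kᴺ, which is a
-- linear subspace for K = ℤₚ with p prime. Primality is imposed by 𝒱₂-ℤ.

module Vectors (K : CommutativeRing 0ℓ 0ℓ) where
  open CommutativeRing K using (+-commutativeMonoid) renaming (Carrier to 𝕂)

  -- Kᴺ with componentwise operations; its product is ⊙.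
  K^_ : ℕ → CommutativeRing 0ℓ 0ℓ
  K^ N = Pointwise.commutativeRing (Fin N) K

  𝔴 : ∀ {N} → (Fin N → 𝕂) → 𝕂
  𝔴 = CMSum.sum +-commutativeMonoid

  infixl 7 _·_
  _·_ : ∀ {N} → 𝕂 → (Fin N → 𝕂) → (Fin N → 𝕂)
  (k · u) i = CommutativeRing._*_ K k (u i)

  record Subspace (N : ℕ) : Set₁ where
    open CommutativeRing (K^ N) using (_≈_; _+_; 0#)
    field
      Mem    : Pred (Fin N → 𝕂) 0ℓ
      resp   : ∀ {u w} → u ≈ w → Mem u → Mem w
      zero-∈ : Mem 0#
      +-∈    : ∀ {u w} → Mem u → Mem w → Mem (u + w)
      ·-∈    : ∀ k {u} → Mem u → Mem (k · u)

module 𝒱₂-Over (K : CommutativeRing 0ℓ 0ℓ) where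
  open Vectors K
  private
    module K = CommutativeRing K
    module V^ (N : ℕ) where
      open CommutativeRing (K^ N) public using (_≈_; +-commutativeMonoid)
        renaming (_*_ to _⊙_; 1# to 𝟏)
      open FinSum +-commutativeMonoid public

  record Triple (D : FinSet) (N : ℕ) : Set₁ where
    open V^ N
    field
      V    : Subspace N
      𝐢    : Fin N → K.Carrier
      𝐯    : ∣ D ∣ → Fin N → K.Carrier
      𝐢∈V  : Subspace.Mem V 𝐢
      𝐯∈V  : ∀ a → Subspace.Mem V (𝐯 a)
      i-𝟏  : 𝐢 ≈ 𝟏
      i-𝔴  : 𝔴 𝐢 K.≈ K.1#
      s    : ∑ D 𝐯 ≈ 𝐢
      o    : ∀ {a b} → a ≢ b → 𝔴 (𝐯 a ⊙ 𝐯 b) K.≈ K.0#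
      p    : ∀ a → 𝔴 (𝐯 a ⊙ 𝐯 a) K.≈ 𝔴 (𝐯 a)

  -- Triples are equal when they live in the same Kᴺ and have equal
  -- components there, subspaces being compared by their elements.

  record _≋_ {D N} (t u : Triple D N) : Set where
    constructor mk≋
    open V^ N
    private
      module t = Triple t
      module u = Triple u
    field
      V≐ : Subspace.Mem t.V ≐ Subspace.Mem u.V
      𝐢≈ : t.𝐢 ≈ u.𝐢
      𝐯≈ : ∀ a → t.𝐯 a ≈ u.𝐯 a

  data _≃_ {D} : Σ ℕ (Triple D) → Σ ℕ (Triple D) → Set₁ where
    same : ∀ {N} {t u : Triple D N} → t ≋ u → (N , t) ≃ (N , u)

  setoid : FinSet → Setoid (lsuc 0ℓ) (lsuc 0ℓ)
  setoid D = record
    { Carrier = Σ ℕ (Triple D)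
    ; _≈_ = _≃_
    ; isEquivalence = record { refl = same ≋-refl ; sym = ≃-sym ; trans = ≃-trans }
    }
    where
    ≋-refl : ∀ {N} {t : Triple D N} → t ≋ t
    ≋-refl = mk≋ (id , id) (λ _ → K.refl) (λ _ _ → K.refl)

    ≃-sym : ∀ {x y : Σ ℕ (Triple D)} → x ≃ y → y ≃ x
    ≃-sym (same (mk≋ (f , g) e e′)) =
      same (mk≋ (g , f) (λ j → K.sym (e j)) (λ a j → K.sym (e′ a j)))

    ≃-trans : ∀ {x y z : Σ ℕ (Triple D)} → x ≃ y → y ≃ z → x ≃ z
    ≃-trans (same (mk≋ (f , g) e e′)) (same (mk≋ (f₁ , g₁) d d′)) =
      same (mk≋ ((λ m → f₁ (f m)) , (λ m → g (g₁ m)))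
                (λ j → K.trans (e j) (d j)) (λ a j → K.trans (e′ a j) (d′ a j)))

  module PushTriple {N : ℕ} where
    open V^ N
    module A = CommutativeRing (K^ N)
    module S = FinSum K.+-commutativeMonoid
    open SetoidReasoning K.setoid

    𝔴-cong : ∀ {u w : Fin N → K.Carrier} → u ≈ w → 𝔴 u K.≈ 𝔴 w
    𝔴-cong = CMSum.sum-cong-≋ K.+-commutativeMonoid

    𝔴-0 : 𝔴 A.0# K.≈ K.0#
    𝔴-0 = CMSum.sum-replicate-zero K.+-commutativeMonoid N

    𝔴-+ : ∀ u w → 𝔴 (u A.+ w) K.≈ 𝔴 u K.+ 𝔴 w
    𝔴-+ = CMSum.∑-distrib-+ K.+-commutativeMonoid

    module H𝔴 = PushHom A.+-commutativeMonoid K.+-commutativeMonoid 𝔴 𝔴-0 𝔴-+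

    module Left (w : Fin N → K.Carrier) = PushHom A.+-commutativeMonoid K.+-commutativeMonoid
      (λ u → 𝔴 (u ⊙ w))
      (K.trans (𝔴-cong (A.zeroˡ w)) 𝔴-0)
      (λ u u′ → K.trans (𝔴-cong (A.distribʳ w u u′)) (𝔴-+ (u ⊙ w) (u′ ⊙ w)))

    module Right (u : Fin N → K.Carrier) = PushHom A.+-commutativeMonoid K.+-commutativeMonoid
      (λ w → 𝔴 (u ⊙ w))
      (K.trans (𝔴-cong (A.zeroʳ u)) 𝔴-0)
      (λ w w′ → K.trans (𝔴-cong (A.distribˡ u w w′)) (𝔴-+ (u ⊙ w) (u ⊙ w′)))

    expand : ∀ D E α (v : ∣ D ∣ → Fin N → K.Carrier) b b′ →
      𝔴 (push D E α v b ⊙ push D E α v b′) K.≈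
      S.push D E α (λ a → S.push D E α (λ a′ → 𝔴 (v a ⊙ v a′)) b′) b
    expand D E α v b b′ = K.trans
      (Left.h-push (push D E α v b′) D E α v b)
      (S.push-cong D E α (λ a → Right.h-push (v a) D E α v b′) b)

    module _ {D} (t : Triple D N) where
      open Triple t
      open Subspace V

      sum-∈ : ∀ {n} (g : Fin n → Fin N → K.Carrier) → (∀ i → Mem (g i)) →
              Mem (CMSum.sum A.+-commutativeMonoid g)
      sum-∈ {ℕ.zero}  g g∈ = zero-∈
      sum-∈ {ℕ.suc n} g g∈ = +-∈ (g∈ zero) (sum-∈ (g ∘ suc) (g∈ ∘ suc))

      when-∈ : ∀ {P : Set} (d : Dec P) {u} → Mem u → Mem (when d u)
      when-∈ (yes _) u∈ = u∈
      when-∈ (no _)  _  = zero-∈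

      pushTriple : ∀ E → (∣ D ∣ → ∣ E ∣) → Triple E N
      pushTriple E α = record
        { V   = V
        ; 𝐢   = 𝐢
        ; 𝐯   = push D E α 𝐯
        ; 𝐢∈V = 𝐢∈V
        ; 𝐯∈V = λ b → sum-∈ _ (λ i → when-∈ (α (FinSet.from D i) ≟ b) (𝐯∈V (FinSet.from D i)))
        ; i-𝟏 = i-𝟏
        ; i-𝔴 = i-𝔴
        ; s   = A.trans (∑-push D E α 𝐯) s
        ; o   = λ {b} {b′} b≢b′ → K.trans (expand D E α 𝐯 b b′)
                  (S.∑-zero D (λ a → S.when-no (α a ≟ b) (λ αa≡b →
                   S.∑-zero D (λ a′ → S.when-no (α a′ ≟ b′) (λ αa′≡b′ →
                     o (λ a≡a′ → b≢b′ (trans (sym αa≡b) (trans (cong α a≡a′) αa′≡b′))))))))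
        ; p   = λ b → begin
            𝔴 (push D E α 𝐯 b ⊙ push D E α 𝐯 b)
              ≈⟨ expand D E α 𝐯 b b ⟩
            S.push D E α (λ a → S.push D E α (B a) b) b
              ≈⟨ S.∑-cong D (λ a → S.when (α a ≟ b) (S.push D E α (B a) b))
                   (λ a → S.when (α a ≟ b) (𝔴 (𝐯 a)))
                   (λ a → S.when-cong (α a ≟ b) (diagonal a b)) ⟩
            S.push D E α (λ a → 𝔴 (𝐯 a)) b
              ≈⟨ H𝔴.h-push D E α 𝐯 b ⟨
            𝔴 (push D E α 𝐯 b) ∎
        }
        where
        open FinSet E using (_≟_)
        B : ∣ D ∣ → ∣ D ∣ → K.Carrier
        B a a′ = 𝔴 (𝐯 a ⊙ 𝐯 a′)
        diagonal : ∀ a b → α a ≡ b → S.push D E α (B a) b K.≈ 𝔴 (𝐯 a)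
        diagonal a b αa≡b = K.trans
          (S.∑-single D (λ a′ → S.when (α a′ ≟ b) (B a a′)) a (λ a′ a′≢a →
            S.when-no (α a′ ≟ b) (λ _ → o (λ a≡a′ → a′≢a (sym a≡a′)))))
          (K.trans (S.when-yes (α a ≟ b) αa≡b) (p a))

  minion : Minion (lsuc 0ℓ) (lsuc 0ℓ)
  minion = record
    { obj = setoid
    ; map = λ {D} {E} α → record
      { to   = λ (N , t) → N , PushTriple.pushTriple t E α
      ; cong = λ { (same {N} (mk≋ V≐ 𝐢≈ 𝐯≈)) →
                   same (mk≋ V≐ 𝐢≈ (V^.push-cong N D E α 𝐯≈)) }
      }
    ; map-resp = λ {D} {E} α≗β (N , t) →
        same (mk≋ (id , id) (λ _ → K.refl) (V^.push-resp N D E α≗β (Triple.𝐯 t)))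
    ; map-id   = λ {D} (N , t) →
        same (mk≋ (id , id) (λ _ → K.refl) (V^.push-id N D (Triple.𝐯 t)))
    ; map-∘    = λ {D} {E} {F} β α (N , t) →
        same (mk≋ (id , id) (λ _ → K.refl) (V^.push-∘ N D E F β α (Triple.𝐯 t)))
    }

𝒱₂-ℤ : (p : ℕ) → Prime p → Minion (lsuc 0ℓ) (lsuc 0ℓ)
𝒱₂-ℤ p _ = 𝒱₂-Over.minion (ℤ/ p)

{-# OPTIONS --safe #-}
-- Let e₀, e₁, e₂ be the standard basis of ℤ₂³, let x be the image in 𝒵₈ of the
-- triple given by (e₀, e₁, e₂), and let u = 𝟏 - eₖ. Since u ⊙ u has even weight,
-- (u, u, 𝟏) also gives a triple; let (y₀, y₁, y₂) be its image. Splitting off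
-- either copy of u gives the pair (u, eₖ), obtained from the basis by merging the
-- two vectors other than eₖ, so y₀ and y₁ both equal zₖ = ∑ⱼ xⱼ over j ≠ k.
-- Merging the two copies gives (0, 𝟏), where 0 is the empty sum, so y₀ + y₁ = 0.
-- Hence 2zₖ = 0, and 4 = 4(x₀ + x₁ + x₂) = 2(z₀ + z₁ + z₂) = 0 modulo 8, which is
-- absurd.
module Submission where

open import Algebra.Bundles using (CommutativeRing)
open import Data.Bool.Base using (if_then_else_)
open import Data.Fin.Base using (Fin)
open import Data.Fin.Patterns using (0F; 1F; 2F)
open import Data.Fin.Properties using (all?; _≟_)
open import Data.Integer.Base using (ℤ; +_; 0ℤ; 1ℤ; _+_; _-_; _*_)
open import Data.Integer.Divisibility.Signed using (_∣?_)
open import Data.Integer.Tactic.RingSolver using (solve-∀)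
open import Data.Nat.Base using (ℕ)
open import Data.Nat.Primality using (prime[2])
open import Data.Product.Base using (_×_; _,_)
open import Data.Unit.Base using (⊤)
open import Function.Base using (id; const)
open import Function.Bundles using (Func; _⟨$⟩_)
open import Function.Construct.Identity using (↔-id)
open import Relation.Binary.PropositionalEquality using (_≡_; _≢_)
import Relation.Binary.Reasoning.Setoid as SetoidReasoning
open import Relation.Nullary using (¬_; Dec; does)
open import Relation.Nullary.Decidable
  using (map′; ¬?; _×-dec_; _→-dec_; from-yes; from-no)
open import Defs

finSet : ℕ → FinSet
finSet n = record { Carrier = Fin n ; size = n ; enumeration = ↔-id (Fin n) }

infix 4 _≡?_[mod_]
_≡?_[mod_] : ∀ x y m → Dec (x ≡ y [mod m ])
x ≡? y [mod m ] = map′ congruent _≡_[mod_].m∣x-y (+ m ∣? x - y)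

open Vectors (ℤ/ 2) using (K^_; 𝔴; Subspace)
open 𝒱₂-Over (ℤ/ 2) using (Triple; same; mk≋)

full : ∀ N → Subspace N
full N = record
  { Mem    = λ _ → ⊤
  ; resp   = λ _ _ → _
  ; zero-∈ = _
  ; +-∈    = λ _ _ → _
  ; ·-∈    = λ _ _ → _
  }

module _ {n N : ℕ} where
  open FinSum (CommutativeRing.+-commutativeMonoid (K^ N)) using (∑)
  open CommutativeRing (K^ N) using () renaming (_*_ to _⊙_)

  -- Conditions (s), (o), (p) for `𝐢` the all-ones vector, in a form that is decidable by finite
  -- checks.
  Orthogonal : (Fin n → Fin N → ℤ) → Set
  Orthogonal v =
    (∀ j → ∑ (finSet n) v j ≡ 1ℤ [mod 2 ]) ×
    (∀ a b → a ≢ b → 𝔴 (v a ⊙ v b) ≡ 0ℤ [mod 2 ]) ×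
    (∀ a → 𝔴 (v a ⊙ v a) ≡ 𝔴 (v a) [mod 2 ])

  orthogonal? : ∀ v → Dec (Orthogonal v)
  orthogonal? v =
    all? (λ j → ∑ (finSet n) v j ≡? 1ℤ [mod 2 ]) ×-dec
    all? (λ a → all? λ b → ¬? (a ≟ b) →-dec (𝔴 (v a ⊙ v b) ≡? 0ℤ [mod 2 ])) ×-dec
    all? (λ a → 𝔴 (v a ⊙ v a) ≡? 𝔴 (v a) [mod 2 ])

  triple : 𝔴 {N} (const 1ℤ) ≡ 1ℤ [mod 2 ] →
           (v : Fin n → Fin N → ℤ) → Orthogonal v → Triple (finSet n) N
  triple odd v (s , o , p) = record
    { V   = full N
    ; 𝐢   = const 1ℤ
    ; 𝐯   = v
    ; 𝐢∈V = _
    ; 𝐯∈V = _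
    ; i-𝟏 = λ _ → CommutativeRing.refl (ℤ/ 2)
    ; i-𝔴 = odd
    ; s   = s
    ; o   = λ {a} {b} → o a b
    ; p   = p
    }

odd-3 : 𝔴 {3} (const 1ℤ) ≡ 1ℤ [mod 2 ]
odd-3 = from-yes (𝔴 {3} (const 1ℤ) ≡? 1ℤ [mod 2 ])

e : Fin 3 → Fin 3 → ℤ
e i j = if does (i ≟ j) then 1ℤ else 0ℤ

doubled : Fin 3 → Fin 3 → Fin 3 → ℤ
doubled k 2F j = 1ℤ
doubled k _  j = 1ℤ - e k j

e-orthogonal : Orthogonal e
e-orthogonal = from-yes (orthogonal? e)

-- With u = 𝟏 - eₖ, the sum u + u + 𝟏 is 𝟏 modulo 2; every product involving u is u, of weight 2.
doubled-orthogonal : ∀ k → Orthogonal (doubled k)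
doubled-orthogonal = from-yes (all? λ k → orthogonal? (doubled k))

-- The opposite orientations make `0F` carry u and `1F` carry eₖ on both sides of the comparison.
split merge : Fin 3 → Fin 3 → Fin 2
split i j = if does (j ≟ i) then 0F else 1F
merge k j = if does (j ≟ k) then 1F else 0F

module _ where
  open FinSum (CommutativeRing.+-commutativeMonoid (K^ 3)) using (push)

  SamePush : (v w : Fin 3 → Fin 3 → ℤ) (α β : Fin 3 → Fin 2) → Set
  SamePush v w α β = ∀ b j →
    push (finSet 3) (finSet 2) α v b j ≡ push (finSet 3) (finSet 2) β w b j [mod 2 ]

  samePush? : ∀ v w α β → Dec (SamePush v w α β)
  samePush? v w α β = all? λ b → all? λ j →
    push (finSet 3) (finSet 2) α v b j ≡? push (finSet 3) (finSet 2) β w b j [mod 2 ]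

module _ (H : MinionHom (𝒱₂-ℤ 2 prime[2]) (𝒵 8)) where
  open MinionHom H
  open CommutativeRing (ℤ/ 8) using (+-cong; *-congˡ; +-commutativeMonoid; reflexive; setoid)
    renaming (sym to ≈-sym; trans to ≈-trans)
  open FinSum +-commutativeMonoid using (push; ∑)
  open SetoidReasoning setoid

  image : Triple (finSet 3) 3 → Fin 3 → ℤ
  image t = 𝒵-Elem.f (ξ (finSet 3) ⟨$⟩ (3 , t))

  -- Naturality on both sides of `ξ`: the pushed triples share the subspace and `𝐢`, so only their
  -- vectors need comparing.
  image-push : ∀ {v w} {ov : Orthogonal v} {ow : Orthogonal w} (α β : Fin 3 → Fin 2) →
    SamePush v w α β → ∀ b →
    push (finSet 3) (finSet 2) α (image (triple odd-3 v ov)) b ≡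
    push (finSet 3) (finSet 2) β (image (triple odd-3 w ow)) b [mod 8 ]
  image-push {ov = ov} {ow} α β same-𝐯 b =
    ≈-trans (≈-sym (natural {finSet 3} {finSet 2} α (3 , triple odd-3 _ ov) b))
    (≈-trans (Func.cong (ξ (finSet 2))
               (same (mk≋ (id , id) (λ _ → CommutativeRing.refl (ℤ/ 2)) same-𝐯)) b)
             (natural {finSet 3} {finSet 2} β (3 , triple odd-3 _ ow) b))

  x z : Fin 3 → ℤ
  x   = image (triple odd-3 e e-orthogonal)
  z k = push (finSet 3) (finSet 2) (merge k) x 0F

  2z≈0 : ∀ k → z k + z k ≡ 0ℤ [mod 8 ]
  2z≈0 k = begin
    z k + z k                        ≈⟨ +-cong first second ⟨
    (y 0F + 0ℤ) + (0ℤ + (y 1F + 0ℤ)) ≈⟨ reflexive (regroup (y 0F) (y 1F)) ⟩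
    y 0F + (y 1F + 0ℤ)               ≈⟨ both ⟩
    0ℤ                               ∎
    where
    y : Fin 3 → ℤ
    y = image (triple odd-3 (doubled k) (doubled-orthogonal k))

    first : y 0F + 0ℤ ≡ z k [mod 8 ]
    first = image-push (split 0F) (merge k)
      -- u + 𝟏 = eₖ modulo 2. Deciding for all `k` at once keeps the decision closed, so that it
      -- evaluates.
      (from-yes (all? λ k → samePush? (doubled k) e (split 0F) (merge k)) k) 0F

    second : 0ℤ + (y 1F + 0ℤ) ≡ z k [mod 8 ]
    second = image-push (split 1F) (merge k)
      (from-yes (all? λ k → samePush? (doubled k) e (split 1F) (merge k)) k) 0F

    both : y 0F + (y 1F + 0ℤ) ≡ 0ℤ [mod 8 ]
    -- The fibre of `const 0F` over `1F` is empty, so the right side is 0 there, matching u + u = 0;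
    -- over `0F` both sides give 𝟏.
    both = image-push {w = e} {ow = e-orthogonal} (split 2F) (const 0F)
      (from-yes (all? λ k → samePush? (doubled k) e (split 2F) (const 0F)) k) 1F

    regroup : ∀ a b → (a + 0ℤ) + (0ℤ + (b + 0ℤ)) ≡ a + (b + 0ℤ)
    regroup = solve-∀

  4≈0 : + 4 ≡ 0ℤ [mod 8 ]
  4≈0 = begin
    + 4 * 1ℤ
      ≈⟨ *-congˡ {x = + 4} (𝒵-Elem.sum-1 (ξ (finSet 3) ⟨$⟩ (3 , triple odd-3 e e-orthogonal))) ⟨
    + 4 * ∑ (finSet 3) x
      ≈⟨ reflexive (count (x 0F) (x 1F) (x 2F)) ⟩
    (z 0F + z 0F) + ((z 1F + z 1F) + (z 2F + z 2F))
      ≈⟨ +-cong (2z≈0 0F) (+-cong (2z≈0 1F) (2z≈0 2F)) ⟩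
    0ℤ ∎
    where
    -- Each `x j` is missing from exactly one `z k`, hence occurs in two of them and four times
    -- after doubling. The `0ℤ` terms are what the pushes leave for indices outside the fibre.
    count : ∀ a b c → + 4 * (a + (b + (c + 0ℤ))) ≡
      ((0ℤ + (b + (c + 0ℤ))) + (0ℤ + (b + (c + 0ℤ)))) +
      (((a + (0ℤ + (c + 0ℤ))) + (a + (0ℤ + (c + 0ℤ)))) +
       ((a + (b + 0ℤ)) + (a + (b + 0ℤ))))
    count = solve-∀

proposition4p7 : ¬ MinionHom (𝒱₂-ℤ 2 prime[2]) (𝒵 8)
proposition4p7 H = from-no (+ 4 ≡? 0ℤ [mod 8 ]) (4≈0 H)
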